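{- Let $A$ and $B$ be simple types, and let $L_A\subseteq\mathrm{Tm}(A)$ and $L_B\subseteq\mathrm{Tm}(B)$ be regular higher-order languages. Define $$L_A\times L_B=\{\,P\in\mathrm{Tm}(A\times B)\mid \pi_1P\in L_A,\ \pi_2P\in L_B\,\}$$ (equivalently, the set of pairs $(M,N)$ with $M\in L_A$, $N\in L_B$, since every closed term of type $A\times B$ is $\beta\eta$-equal to a pair), and $$L_A\Rightarrow L_B=\{\,M\in\mathrm{Tm}(A\Rightarrow B)\mid \forall P\in\mathrm{Tm}(A),\ P\in L_A\Rightarrow MP\in L_B\,\}.$$ Then $L_A\times L_B$ is a regular higher-order language of type $A\times B$ and $L_A\Rightarrow L_B$ is a regular higher-order language of type $A\Rightarrow B$.
   Context: Simple types are generated by the grammar $A,B::=A\times B\mid A\Rightarrow B\mid 1\mid o$ with a single base type $o$. For a simple type $A$, $\mathrm{Tm}(A)$ denotes the set of closed simply-typed $\lambda$-terms (with pairing, projections $\pi_1,\pi_2$ and a unit term) of type $A$, taken modulo $\beta\eta$-conversion. A higher-order language of type $A$ is a subset $L\subseteq\mathrm{Tm}(A)$. For a finite set $Q$, let $[\![-]\!]_Q$ be the standard interpretation of types and terms in the cartesian closed category of finite sets, with $[\![o]\!]_Q=Q$. A language $L\subseteq\mathrm{Tm}(A)$ is $Q$-regular if there is a subset $F\subseteq[\![A]\!]_Q$ with $L=\{M\in\mathrm{Tm}(A)\mid [\![M]\!]_Q\in F\}$; $L$ is regular if it is $Q$-regular for some finite set $Q$. -}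

module Defs where

open import Data.Nat using (ℕ)
open import Data.Fin using (Fin)
open import Data.List using (List; []; _∷_)
open import Data.Unit using (⊤; tt)
open import Data.Product using (_×_; _,_; proj₁; proj₂; Σ; ∃)
open import Relation.Binary.PropositionalEquality using (_≡_)

infixr 7 _⇒_
infixr 8 _⊗_
data Ty : Set where
  _⊗_ : Ty → Ty → Ty
  _⇒_ : Ty → Ty → Ty
  𝟙   : Ty
  o   : Ty

Ctx : Set
Ctx = List Ty

data _∋_ : Ctx → Ty → Set where
  here  : ∀ {Γ A} → (A ∷ Γ) ∋ A
  there : ∀ {Γ A B} → Γ ∋ A → (B ∷ Γ) ∋ A

data Term (Γ : Ctx) : Ty → Set where
  var  : ∀ {A} → Γ ∋ A → Term Γ A
  lam  : ∀ {A B} → Term (A ∷ Γ) B → Term Γ (A ⇒ B)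
  app  : ∀ {A B} → Term Γ (A ⇒ B) → Term Γ A → Term Γ B
  pair : ∀ {A B} → Term Γ A → Term Γ B → Term Γ (A ⊗ B)
  π₁   : ∀ {A B} → Term Γ (A ⊗ B) → Term Γ A
  π₂   : ∀ {A B} → Term Γ (A ⊗ B) → Term Γ B
  unit : Term Γ 𝟙

Ren : Ctx → Ctx → Set
Ren Γ Δ = ∀ {A} → Γ ∋ A → Δ ∋ A

liftR : ∀ {Γ Δ B} → Ren Γ Δ → Ren (B ∷ Γ) (B ∷ Δ)
liftR ρ here      = here
liftR ρ (there x) = there (ρ x)

rename : ∀ {Γ Δ A} → Ren Γ Δ → Term Γ A → Term Δ A
rename ρ (var x)    = var (ρ x)
rename ρ (lam M)    = lam (rename (liftR ρ) M)
rename ρ (app M N)  = app (rename ρ M) (rename ρ N)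
rename ρ (pair M N) = pair (rename ρ M) (rename ρ N)
rename ρ (π₁ M)     = π₁ (rename ρ M)
rename ρ (π₂ M)     = π₂ (rename ρ M)
rename ρ unit       = unit

weaken : ∀ {Γ A B} → Term Γ A → Term (B ∷ Γ) A
weaken = rename there

Sub : Ctx → Ctx → Set
Sub Γ Δ = ∀ {A} → Γ ∋ A → Term Δ A

liftS : ∀ {Γ Δ B} → Sub Γ Δ → Sub (B ∷ Γ) (B ∷ Δ)
liftS σ here      = var here
liftS σ (there x) = weaken (σ x)

subst : ∀ {Γ Δ A} → Sub Γ Δ → Term Γ A → Term Δ A
subst σ (var x)    = σ x
subst σ (lam M)    = lam (subst (liftS σ) M)
subst σ (app M N)  = app (subst σ M) (subst σ N)
subst σ (pair M N) = pair (subst σ M) (subst σ N)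
subst σ (π₁ M)     = π₁ (subst σ M)
subst σ (π₂ M)     = π₂ (subst σ M)
subst σ unit       = unit

single : ∀ {Γ B} → Term Γ B → Sub (B ∷ Γ) Γ
single N here      = N
single N (there x) = var x

_[_] : ∀ {Γ A B} → Term (B ∷ Γ) A → Term Γ B → Term Γ A
M [ N ] = subst (single N) M

infix 4 _≈βη_
data _≈βη_ {Γ : Ctx} : ∀ {A} → Term Γ A → Term Γ A → Set where
  β⇒   : ∀ {A B} (M : Term (A ∷ Γ) B) (N : Term Γ A) → app (lam M) N ≈βη M [ N ]
  β₁   : ∀ {A B} (M : Term Γ A) (N : Term Γ B) → π₁ (pair M N) ≈βη M
  β₂   : ∀ {A B} (M : Term Γ A) (N : Term Γ B) → π₂ (pair M N) ≈βη N
  η⇒   : ∀ {A B} (M : Term Γ (A ⇒ B)) → M ≈βη lam (app (weaken M) (var here))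
  η⊗   : ∀ {A B} (M : Term Γ (A ⊗ B)) → M ≈βη pair (π₁ M) (π₂ M)
  η𝟙   : (M : Term Γ 𝟙) → M ≈βη unit
  refl≈  : ∀ {A} {M : Term Γ A} → M ≈βη M
  sym≈   : ∀ {A} {M N : Term Γ A} → M ≈βη N → N ≈βη M
  trans≈ : ∀ {A} {M N P : Term Γ A} → M ≈βη N → N ≈βη P → M ≈βη P
  lam≈   : ∀ {A B} {M M' : Term (A ∷ Γ) B} → M ≈βη M' → lam M ≈βη lam M'
  app≈   : ∀ {A B} {M M' : Term Γ (A ⇒ B)} {N N' : Term Γ A} →
           M ≈βη M' → N ≈βη N' → app M N ≈βη app M' N'
  pair≈  : ∀ {A B} {M M' : Term Γ A} {N N' : Term Γ B} →
           M ≈βη M' → N ≈βη N' → pair M N ≈βη pair M' N'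
  π₁≈    : ∀ {A B} {M M' : Term Γ (A ⊗ B)} → M ≈βη M' → π₁ M ≈βη π₁ M'
  π₂≈    : ∀ {A B} {M M' : Term Γ (A ⊗ B)} → M ≈βη M' → π₂ M ≈βη π₂ M'

-- closed terms of type A (Tm(A) is this set modulo _≈βη_)
Tm : Ty → Set
Tm A = Term [] A

-- A higher-order language of type A: a subset of Tm(A) modulo βη, i.e. a
-- predicate on closed terms that is invariant under βη-conversion.
record Language (A : Ty) : Set₁ where
  field
    _∈L : Tm A → Set
    βη-closed : ∀ {M N : Tm A} → M ≈βη N → _∈L M → _∈L N
open Language public

-- Interpretation in the CCC of finite sets, with ⟦o⟧ = Q = Fin n
⟦_⟧T : Ty → ℕ → Set
⟦ A ⊗ B ⟧T n = ⟦ A ⟧T n × ⟦ B ⟧T n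
⟦ A ⇒ B ⟧T n = ⟦ A ⟧T n → ⟦ B ⟧T n
⟦ 𝟙 ⟧T n     = ⊤
⟦ o ⟧T n     = Fin n

⟦_⟧C : Ctx → ℕ → Set
⟦ [] ⟧C n    = ⊤
⟦ A ∷ Γ ⟧C n = ⟦ A ⟧T n × ⟦ Γ ⟧C n

⟦_⟧V : ∀ {Γ A} → Γ ∋ A → (n : ℕ) → ⟦ Γ ⟧C n → ⟦ A ⟧T n
⟦ here ⟧V n (a , γ)    = a
⟦ there x ⟧V n (a , γ) = ⟦ x ⟧V n γ

⟦_⟧ : ∀ {Γ A} → Term Γ A → (n : ℕ) → ⟦ Γ ⟧C n → ⟦ A ⟧T n
⟦ var x ⟧ n γ    = ⟦ x ⟧V n γ
⟦ lam M ⟧ n γ    = λ a → ⟦ M ⟧ n (a , γ)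
⟦ app M N ⟧ n γ  = ⟦ M ⟧ n γ (⟦ N ⟧ n γ)
⟦ pair M N ⟧ n γ = ⟦ M ⟧ n γ , ⟦ N ⟧ n γ
⟦ π₁ M ⟧ n γ     = proj₁ (⟦ M ⟧ n γ)
⟦ π₂ M ⟧ n γ     = proj₂ (⟦ M ⟧ n γ)
⟦ unit ⟧ n γ     = tt

⟦_⟧₀ : ∀ {A} → Tm A → (n : ℕ) → ⟦ A ⟧T n
⟦ M ⟧₀ n = ⟦ M ⟧ n tt

QRegular : ∀ {A} → ℕ → Language A → Set₁
QRegular {A} n L =
  Σ (⟦ A ⟧T n → Set) λ F → ∀ (M : Tm A) → ((L ∈L) M → F (⟦ M ⟧₀ n)) × (F (⟦ M ⟧₀ n) → (L ∈L) M)

-- L is regular: Q-regular for some finite set Q (w.l.o.g. Q = Fin n)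
Regular : ∀ {A} → Language A → Set₁
Regular L = ∃ λ n → QRegular n L

_×L_ : ∀ {A B} → Language A → Language B → Language (A ⊗ B)
_∈L (LA ×L LB) P = (LA ∈L) (π₁ P) × (LB ∈L) (π₂ P)
βη-closed (LA ×L LB) e (p , q) =
  βη-closed LA (π₁≈ e) p , βη-closed LB (π₂≈ e) q

_⇒L_ : ∀ {A B} → Language A → Language B → Language (A ⇒ B)
_∈L (LA ⇒L LB) M = ∀ (P : Tm _) → (LA ∈L) P → (LB ∈L) (app M P)
βη-closed (LA ⇒L LB) e h P p = βη-closed LB (app≈ e refl≈) (h P p)

{-# OPTIONS --safe #-}
-- The denotation of an application is the application of the denotations, so
-- LA ⇒ LB is recognised over the same Q as LB.  For LA × LB both languages must
-- first be recognised over a common Q.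
--
-- Passing from size n to suc n uses a retraction with lower ∘ raise = id at
-- base type and raise = suc there; lower sends ⟦ M ⟧ (suc n) to ⟦ M ⟧ n.
-- Without function extensionality this cannot be shown pointwise: it is an
-- equality of functions of the environment, obtained from a Kripke logical
-- relation whose worlds are arbitrary sets of environments, so that passing
-- under a λ is currying, which is a congruence.  This works because lowering a
-- successor computes for an open argument.
--
-- A zero is lowered to a default element of Fin n, which does not exist if n = 0.
-- However, a type inhabited over Fin 0 has, for each of its final conclusions o,
-- an uninhabited argument type, and that argument replaces the default.
module Submission where

open import Defs
open import Data.Nat using (ℕ; zero; suc; _+_)
open import Data.Nat.Properties using (+-comm)
open import Data.Fin using (Fin; zero; suc)
open import Data.Empty using (⊥-elim)
open import Data.Unit using (⊤; tt)
open import Data.List using ([]; _∷_)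
open import Data.Product using (_×_; _,_; proj₁; proj₂; Σ)
open import Data.Sum using (_⊎_; inj₁; inj₂)
open import Function using (_∘_; id; const)
open import Level using (Lift; lift) renaming (lower to unlift)
open import Relation.Nullary using (¬_)
open import Relation.Binary.PropositionalEquality as ≡
  using (_≡_; refl; sym; trans; cong; cong₂)

lowerFin : ∀ {n} → Fin n → Fin (suc n) → Fin n
lowerFin z zero    = z
lowerFin z (suc i) = i

mutual
  raise : ∀ {n} A → Fin n → ⟦ A ⟧T n → ⟦ A ⟧T (suc n)
  raise (A ⊗ B) z (a , b) = raise A z a , raise B z b
  raise (A ⇒ B) z g       = λ a → raise B z (g (lower A z a))
  raise 𝟙       z _       = tt
  raise o       z i       = suc i

  lower : ∀ {n} A → Fin n → ⟦ A ⟧T (suc n) → ⟦ A ⟧T n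
  lower (A ⊗ B) z (a , b) = lower A z a , lower B z b
  lower (A ⇒ B) z f       = λ a → lower B z (f (raise A z a))
  lower 𝟙       z _       = tt
  lower o       z i       = lowerFin z i

Rel : ∀ {n} A {Y : Set} → (Y → ⟦ A ⟧T (suc n)) → (Y → ⟦ A ⟧T n) → Set₁
Rel (A ⊗ B) f g = Rel A (proj₁ ∘ f) (proj₁ ∘ g) × Rel B (proj₂ ∘ f) (proj₂ ∘ g)
Rel {n} (A ⇒ B) {Y} f g =
  ∀ {Z : Set} (q : Z → Y) (a : Z → ⟦ A ⟧T (suc n)) (b : Z → ⟦ A ⟧T n) →
  Rel A a b → Rel B (λ z → f (q z) (a z)) (λ z → g (q z) (b z))
Rel 𝟙 f g = Lift _ ⊤
Rel o f g = Lift _ (f ≡ suc ∘ g)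

Rel-reindex : ∀ {n} A {Y Z : Set} (q : Z → Y)
              (f : Y → ⟦ A ⟧T (suc n)) (g : Y → ⟦ A ⟧T n) →
              Rel A f g → Rel A (f ∘ q) (g ∘ q)
Rel-reindex (A ⊗ B) q f g (r , s) =
  Rel-reindex A q (proj₁ ∘ f) (proj₁ ∘ g) r , Rel-reindex B q (proj₂ ∘ f) (proj₂ ∘ g) s
Rel-reindex (A ⇒ B) q f g r = λ q′ → r (q ∘ q′)
Rel-reindex 𝟙       q f g r = lift tt
Rel-reindex o       q f g r = lift (cong (_∘ q) (unlift r))

mutual
  -- Mutual with `reify` because `raise` and `lower` swap in the domain of an arrow. The default `d`
  -- varies with the environment, so that in `lower-⟦⟧₀` it can be the environment itself.
  reflect : ∀ {n} A {Y : Set} (d : Y → Fin n)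
            (f : Y → ⟦ A ⟧T (suc n)) (g : Y → ⟦ A ⟧T n) →
            f ≡ (λ y → raise A (d y) (g y)) → Rel A f g
  reflect (A ⊗ B) d f g e =
    reflect A d (proj₁ ∘ f) (proj₁ ∘ g) (cong (proj₁ ∘_) e) ,
    reflect B d (proj₂ ∘ f) (proj₂ ∘ g) (cong (proj₂ ∘_) e)
  reflect (A ⇒ B) d f g e q a b r =
    reflect B (d ∘ q) _ _
      (trans (cong (λ h z → h (q z) (a z)) e)
             -- Unfolding `raise` has exposed `lower` of the argument `a`, which `reify` turns into
             -- `b`.
             (cong (λ h z → raise B (d (q z)) (g (q z) (h z))) (reify A (d ∘ q) a b r)))
  reflect 𝟙 d f g e = lift tt
  reflect o d f g e = lift e

  reify : ∀ {n} A {Y : Set} (d : Y → Fin n)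
          (f : Y → ⟦ A ⟧T (suc n)) (g : Y → ⟦ A ⟧T n) →
          Rel A f g → (λ y → lower A (d y) (f y)) ≡ g
  reify (A ⊗ B) d f g (r , s) =
    cong₂ (λ h k y → h y , k y)
      (reify A d (proj₁ ∘ f) (proj₁ ∘ g) r)
      (reify B d (proj₂ ∘ f) (proj₂ ∘ g) s)
  reify {n} (A ⇒ B) {Y} d f g r =
    -- The world `⟦ A ⟧T n × Y` adjoins a generic argument `proj₁`, related to its raising by
    -- `reflect`.
    cong (λ h y a → h (a , y))
      (reify B (d ∘ proj₂)
        (λ (a , y) → f y (raise A (d y) a)) (λ (a , y) → g y a)
        (r proj₂ (λ (a , y) → raise A (d y) a) proj₁
          (reflect A {⟦ A ⟧T n × Y} (d ∘ proj₂) _ proj₁ refl)))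
  reify 𝟙 d f g r = refl
  reify o d f g r = cong (λ h y → lowerFin (d y) (h y)) (unlift r)

RelEnv : ∀ {n} Γ {Y : Set} → (Y → ⟦ Γ ⟧C (suc n)) → (Y → ⟦ Γ ⟧C n) → Set₁
RelEnv {n} Γ γ δ = ∀ {A} (x : Γ ∋ A) → Rel A (⟦ x ⟧V (suc n) ∘ γ) (⟦ x ⟧V n ∘ δ)

fundamental : ∀ {n Γ A} (M : Term Γ A) {Y : Set}
              (γ : Y → ⟦ Γ ⟧C (suc n)) (δ : Y → ⟦ Γ ⟧C n) → RelEnv Γ γ δ →
              Rel A (⟦ M ⟧ (suc n) ∘ γ) (⟦ M ⟧ n ∘ δ)
fundamental (var x) γ δ ρ = ρ x
fundamental {n} {Γ} {A ⇒ B} (lam M) γ δ ρ {Z} q a b r =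
  fundamental M (λ z → a z , γ (q z)) (λ z → b z , δ (q z)) ρ′
  where
  ρ′ : RelEnv (A ∷ Γ) {Z} (λ z → a z , γ (q z)) (λ z → b z , δ (q z))
  ρ′ here          = r
  ρ′ {C} (there x) = Rel-reindex C q (⟦ x ⟧V (suc n) ∘ γ) (⟦ x ⟧V n ∘ δ) (ρ x)
fundamental (app M N) γ δ ρ = fundamental M γ δ ρ id _ _ (fundamental N γ δ ρ)
fundamental (pair M N) γ δ ρ = fundamental M γ δ ρ , fundamental N γ δ ρ
fundamental (π₁ M) γ δ ρ = proj₁ (fundamental M γ δ ρ)
fundamental (π₂ M) γ δ ρ = proj₂ (fundamental M γ δ ρ)
fundamental unit γ δ ρ = lift tt

-- Taking `Fin n` as the world and `id` as the default gives an equation that is meaningful even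
-- before any default is known to exist.
lower-⟦⟧₀ : ∀ {n A} (M : Tm A) →
            (λ z → lower A z (⟦ M ⟧₀ (suc n))) ≡ (λ (z : Fin n) → ⟦ M ⟧₀ n)
lower-⟦⟧₀ {A = A} M = reify A id _ _ (fundamental M (const tt) (const tt) λ ())

-- Removes the dependency on a default element from a value that does not use it.
Extract : ∀ n → Ty → Set
Extract n A = Σ ((Fin n → ⟦ A ⟧T n) → ⟦ A ⟧T n) λ ext → ext ∘ const ≡ id

extract₀ : ∀ A → Extract 0 A ⊎ ¬ ⟦ A ⟧T 0
extract₀ (A ⊗ B) with extract₀ A | extract₀ B
... | inj₂ ¬a | _       = inj₂ (¬a ∘ proj₁)
... | inj₁ _  | inj₂ ¬b = inj₂ (¬b ∘ proj₂)
... | inj₁ (ext , p) | inj₁ (ext′ , p′) =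
  inj₁ ((λ h → ext (proj₁ ∘ h) , ext′ (proj₂ ∘ h)) ,
        cong₂ (λ k k′ (a , b) → k a , k′ b) p p′)
extract₀ (A ⇒ B) with extract₀ A | extract₀ B
... | inj₂ ¬a | _ = inj₁ ((λ h a → h (⊥-elim (¬a a)) a) , refl)
-- The empty function out of `Fin 0` lets `ext` produce an element of `⟦ A ⟧T 0` to feed to `f`.
... | inj₁ (ext , _) | inj₂ ¬b = inj₂ (λ f → ¬b (f (ext λ ())))
... | inj₁ _ | inj₁ (ext , p) =
  inj₁ ((λ h a → ext λ z → h z a) , cong (λ k f a → k (f a)) p)
extract₀ 𝟙 = inj₁ ((λ _ → tt) , refl)
extract₀ o = inj₂ λ ()

extract : ∀ n A → Extract n A ⊎ ¬ ⟦ A ⟧T n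
extract zero    A = extract₀ A
extract (suc n) A = inj₁ ((λ h → h zero) , refl)

QRegular-suc : ∀ {n A} (L : Language A) → QRegular n L → QRegular (suc n) L
QRegular-suc {n} {A} L (F , F-spec) with extract n A
-- A closed term would denote an element of the empty `⟦ A ⟧T n`, so `Tm A` is empty and any
-- predicate serves.
... | inj₂ ¬a = (λ _ → ⊤) , λ M → ⊥-elim (¬a (⟦ M ⟧₀ n))
... | inj₁ (ext , ext-const) = F ∘ collapse , λ M →
    (λ m → ≡.subst F (sym (collapse-⟦⟧₀ M)) (proj₁ (F-spec M) m)) ,
    (λ w → proj₂ (F-spec M) (≡.subst F (collapse-⟦⟧₀ M) w))
  where
  collapse : ⟦ A ⟧T (suc n) → ⟦ A ⟧T n
  collapse x = ext λ z → lower A z x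

  collapse-⟦⟧₀ : ∀ M → collapse (⟦ M ⟧₀ (suc n)) ≡ ⟦ M ⟧₀ n
  collapse-⟦⟧₀ M = trans (cong ext (lower-⟦⟧₀ M)) (cong (λ k → k (⟦ M ⟧₀ n)) ext-const)

QRegular-+ : ∀ k {n A} (L : Language A) → QRegular n L → QRegular (k + n) L
QRegular-+ zero    L r = r
QRegular-+ (suc k) L r = QRegular-suc L (QRegular-+ k L r)

QRegular-×L : ∀ {n A B} (LA : Language A) (LB : Language B) →
              QRegular n LA → QRegular n LB → QRegular n (LA ×L LB)
QRegular-×L LA LB (F , F-spec) (G , G-spec) =
  (λ (a , b) → F a × G b) , λ P →
    (λ (p , q) → proj₁ (F-spec (π₁ P)) p , proj₁ (G-spec (π₂ P)) q) ,
    (λ (u , v) → proj₂ (F-spec (π₁ P)) u , proj₂ (G-spec (π₂ P)) v)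

QRegular-⇒L : ∀ {n A B} (LA : Language A) (LB : Language B) →
              QRegular n LB → QRegular n (LA ⇒L LB)
QRegular-⇒L {n} LA LB (G , G-spec) =
  -- The test arguments are the denotations of terms in `LA`, so each test is an instance of
  -- `G-spec` at `app M P`.
  (λ f → ∀ P → (LA ∈L) P → G (f (⟦ P ⟧₀ n))) , λ M →
    (λ m P p → proj₁ (G-spec (app M P)) (m P p)) ,
    (λ w P p → proj₂ (G-spec (app M P)) (w P p))

theoremA : ∀ {A B : Ty} (LA : Language A) (LB : Language B) →
    Regular LA → Regular LB →
    Regular (LA ×L LB) × Regular (LA ⇒L LB)
theoremA LA LB (n , rA) (m , rB) =
  (n + m , QRegular-×L LA LB rA′ (QRegular-+ n LB rB)) , (m , QRegular-⇒L LA LB rB)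
  where
  rA′ : QRegular (n + m) LA
  rA′ = ≡.subst (λ k → QRegular k LA) (+-comm m n) (QRegular-+ m LA rA)
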